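{- For every integer $n>1$, $$r_3(\mathbb{Z}_4^n)\ \geq\ \max_{0\leq t\leq n}\ \sum_{i=t+1}^n \binom{n}{i}\,C(i,i-t),$$ where $t$ ranges over integers.
   Context: $\mathbb{Z}_m^n$ denotes the additive group $(\mathbb{Z}/m\mathbb{Z})^n$. A proper arithmetic progression of length $k$ in $\mathbb{Z}_m^n$ is a sequence $x, x+d, \ldots, x+(k-1)d$ (with $x,d\in\mathbb{Z}_m^n$) whose $k$ elements are pairwise distinct. $r_k(\mathbb{Z}_m^n)$ denotes the maximal size of a set $S\subseteq\mathbb{Z}_m^n$ that does not contain a proper arithmetic progression of length $k$. $C(m,d)$ denotes the largest possible size of a (possibly non-linear) binary code in $\mathbb{F}_2^m$ with minimum Hamming distance at least $d$, i.e. the largest size of a subset of $\mathbb{F}_2^m$ any two distinct elements of which differ in at least $d$ coordinates. -}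

module Defs where

open import Data.Fin using (Fin; toℕ; _≟_)
import Data.Fin.Properties as Fin
open import Data.List using (List; []; _∷_; _++_; map; filter; length; iterate; allFin; applyUpTo; cartesianProductWith)
open import Data.List.Extrema.Nat using (max)
import Data.List.Membership.DecPropositional as DecMembership
open import Data.List.Membership.Propositional using (_∈_)
open import Data.List.Relation.Unary.All using (All; all?)
open import Data.List.Relation.Unary.Unique.Propositional using (Unique)
import Data.List.Relation.Unary.Unique.DecPropositional as DecUnique
open import Data.Nat using (ℕ; zero; suc; _+_; _∸_; _≤_; _≤?_; NonZero)
open import Data.Nat.DivMod using (_mod_)
open import Data.Nat.ListAction using (sum)
open import Data.Product using (∃; ∃₂; _×_; _,_; uncurry)
open import Data.Vec using (Vec; []; _∷_; zipWith; zip; count)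
import Data.Vec.Properties as Vec
open import Relation.Binary.Definitions using (DecidableEquality)
open import Relation.Binary.PropositionalEquality using (_≢_)
open import Relation.Nullary using (¬_; Dec)
open import Relation.Nullary.Decidable using (map′; ¬?; _×-dec_; _→-dec_)
open import Relation.Unary using (Pred; Decidable)
open import Level using (0ℓ)

range : ℕ → ℕ → List ℕ
range a b = applyUpTo (a +_) (suc b ∸ a)

∑ : ℕ → ℕ → (ℕ → ℕ) → ℕ
∑ a b f = sum (map f (range a b))

-- The base value 0 only matters when the range is empty.
Max : ℕ → ℕ → (ℕ → ℕ) → ℕ
Max a b f = max 0 (map f (range a b))

-- The set underlying (ℤ/m)ⁿ; for m = 2 it is also the set underlying 𝔽₂ⁿ.
ℤ/_^_ : ℕ → ℕ → Set
ℤ/ m ^ n = Vec (Fin m) n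

_⊕_ : ∀ {m n} .{{_ : NonZero m}} → ℤ/ m ^ n → ℤ/ m ^ n → ℤ/ m ^ n
_⊕_ {m} = zipWith (λ a b → (toℕ a + toℕ b) mod m)

_≟ᵛ_ : ∀ {m n} → DecidableEquality (ℤ/ m ^ n)
_≟ᵛ_ = Vec.≡-dec _≟_

elements : ∀ m n → List (ℤ/ m ^ n)
elements m zero    = [] ∷ []
elements m (suc n) = cartesianProductWith _∷_ (allFin m) (elements m n)

sublists : ∀ {A : Set} → List A → List (List A)
sublists []       = [] ∷ []
sublists (x ∷ xs) = map (x ∷_) (sublists xs) ++ sublists xs

-- The largest size of a subset of (ℤ/m)ⁿ with property P. Since elements m n
-- has no repetitions, its sublists represent every subset exactly once. P is
-- meant to depend only on which elements belong to the list. The value is 0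
-- if no subset has property P.
maxSize : ∀ {m n} {P : Pred (List (ℤ/ m ^ n)) 0ℓ} → Decidable P → ℕ
maxSize {m} {n} P? = max 0 (map length (filter P? (sublists (elements m n))))

module _ {m n : ℕ} .{{_ : NonZero m}} where

  -- x , x + d , … , x + (k - 1) d
  progression : ℕ → ℤ/ m ^ n → ℤ/ m ^ n → List (ℤ/ m ^ n)
  progression k x d = iterate (_⊕ d) x k

  ContainsProperAP : ℕ → Pred (List (ℤ/ m ^ n)) 0ℓ
  ContainsProperAP k S =
    ∃₂ λ x d → Unique (progression k x d) × All (_∈ S) (progression k x d)

  APFree : ℕ → Pred (List (ℤ/ m ^ n)) 0ℓ
  APFree k S = ¬ ContainsProperAP k S

any-vec? : ∀ {m n} {P : Pred (ℤ/ m ^ n) 0ℓ} → Decidable P → Dec (∃ P)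
any-vec? {n = zero}  P? = map′ ([] ,_) (λ { ([] , p) → p }) (P? [])
any-vec? {n = suc n} P? =
  map′ (λ { (a , v , p) → a ∷ v , p }) (λ { (a ∷ v , p) → a , v , p })
       (Fin.any? λ a → any-vec? λ v → P? (a ∷ v))

apFree? : ∀ {m n} .{{_ : NonZero m}} k → Decidable (APFree {m} {n} k)
apFree? k S = ¬? (any-vec? λ x → any-vec? λ d →
  unique? (progression k x d) ×-dec all? (_∈? S) (progression k x d))
  where
  open DecUnique _≟ᵛ_ using (unique?)
  open DecMembership _≟ᵛ_ using (_∈?_)

r : (k m n : ℕ) .{{_ : NonZero m}} → ℕ
r k m n = maxSize {m} {n} (apFree? k)

hamming : ∀ {m} → ℤ/ 2 ^ m → ℤ/ 2 ^ m → ℕ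
hamming u v = count (uncurry λ a b → ¬? (a ≟ b)) (zip u v)

MinDistance≥ : ∀ {m} → ℕ → Pred (List (ℤ/ 2 ^ m)) 0ℓ
MinDistance≥ d S = All (λ u → All (λ v → u ≢ v → d ≤ hamming u v) S) S

minDistance≥? : ∀ {m} d → Decidable (MinDistance≥ {m} d)
minDistance≥? d S =
  all? (λ u → all? (λ v → ¬? (u ≟ᵛ v) →-dec (d ≤? hamming u v)) S) S

-- The number C(m, d) of coding theory (also written A₂(m, d)), renamed to
-- avoid a clash with the library's binomial coefficient _C_.
codeSize : (m d : ℕ) → ℕ
codeSize m d = maxSize {2} {m} (minDistance≥? d)

-- Fix t and, for each i > t, an optimal code Kᵢ of length i and distance i ∸ t.
-- Take all x in ℤ₄ⁿ whose odd coordinates equal 1 and whose even coordinates,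
-- halved, spell a word of Kᵢ, where i > t is the number of even coordinates;
-- there are (n C i) * length Kᵢ of them for each i. If x , y , z is a proper
-- progression in this set, then x and z have the same even coordinates and
-- differ exactly where the parity of y differs from theirs, which can only
-- happen at even coordinates. So y has i ∸ hamming u v even coordinates, where
-- u ≢ v are the words of x and z, and this is at most t: a contradiction.
module Submission where

open import Defs
open import Data.Nat using (ℕ; _+_; _*_; _∸_; _<_; _≥_)
open import Data.Nat.Combinatorics using (_C_)

open import Algebra.Properties.CommutativeSemigroup using (interchange)
open import Data.Bool using (true; false)
open import Data.Empty using (⊥)
open import Data.Fin using (Fin)
open import Data.Fin.Patterns using (0F; 1F; 2F; 3F)
open import Data.List using (List; []; _∷_; _++_; allFin; applyUpTo; cartesianProductWith; filter; length; map)
open import Data.List.Extrema.Nat using (argmax-all; max≤v⁺; xs≤max)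
import Data.List.Membership.DecPropositional as DecMembership
open import Data.List.Membership.Propositional using (_∈_)
open import Data.List.Membership.Propositional.Properties using (∈-++⁺ˡ; ∈-++⁺ʳ; ∈-++⁻; ∈-filter⁺; ∈-filter⁻; ∈-map⁺; ∈-map⁻)
open import Data.List.Properties using (filter-++; filter-all; filter-none; length-++; map-applyUpTo)
open import Data.List.Relation.Binary.Sublist.Propositional using (_⊆_; []; _∷_; _∷ʳ_)
open import Data.List.Relation.Binary.Sublist.Heterogeneous.Properties using (length-mono-≤; ⊆-filter-Sublist)
open import Data.List.Relation.Unary.All using (All; []; _∷_; lookup; tabulate; universal)
import Data.List.Relation.Unary.All.Properties as All
open import Data.List.Relation.Unary.Any using (here)
open import Data.List.Relation.Unary.AllPairs using (_∷_)
open import Data.Nat using (zero; suc; _≤_; _<?_; z≤n)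
open import Data.Nat.Combinatorics using (k>n⇒nCk≡0; nCk+nC[k+1]≡[n+1]C[k+1])
open import Data.Nat.ListAction using (sum)
open import Data.Nat.Properties
open import Data.Product using (∃; ∃₂; _×_; _,_; proj₁; proj₂)
open import Data.Sum using (inj₁; inj₂)
open import Data.Vec using ([]; _∷_)
open import Function using (_∘_; id)
open import Level using (0ℓ)
open import Relation.Binary.PropositionalEquality
open import Relation.Nullary using (does; no)
open import Relation.Nullary.Decidable using (_×-dec_)
open import Relation.Unary using (Decidable; Pred)

-- Sums over initial segments of ℕ

∑< : ℕ → (ℕ → ℕ) → ℕ
∑< n f = sum (applyUpTo f n)

∑<-cong : ∀ n {f g : ℕ → ℕ} → (∀ k → f k ≡ g k) → ∑< n f ≡ ∑< n g
∑<-cong zero    eq = refl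
∑<-cong (suc n) eq = cong₂ _+_ (eq 0) (∑<-cong n (eq ∘ suc))

∑<-mono : ∀ n {f g : ℕ → ℕ} → (∀ k → f k ≤ g k) → ∑< n f ≤ ∑< n g
∑<-mono zero    f≤g = z≤n
∑<-mono (suc n) f≤g = +-mono-≤ (f≤g 0) (∑<-mono n (f≤g ∘ suc))

∑<-+ : ∀ n (f g : ℕ → ℕ) → ∑< n (λ k → f k + g k) ≡ ∑< n f + ∑< n g
∑<-+ zero    f g = refl
∑<-+ (suc n) f g = begin
  (f 0 + g 0) + ∑< n (λ k → f (suc k) + g (suc k))    ≡⟨ cong (_ +_) (∑<-+ n (f ∘ suc) (g ∘ suc)) ⟩
  (f 0 + g 0) + (∑< n (f ∘ suc) + ∑< n (g ∘ suc))     ≡⟨ interchange +-commutativeSemigroup (f 0) (g 0) _ _ ⟩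
  (f 0 + ∑< n (f ∘ suc)) + (g 0 + ∑< n (g ∘ suc))     ∎
  where open ≡-Reasoning

∑<-last : ∀ n (f : ℕ → ℕ) → ∑< (suc n) f ≡ ∑< n f + f n
∑<-last zero    f = +-comm (f 0) 0
∑<-last (suc n) f = trans (cong (f 0 +_) (∑<-last n (f ∘ suc))) (sym (+-assoc (f 0) _ _))

∑<-tail : ∀ a n (f : ℕ → ℕ) → ∑< (n ∸ a) (f ∘ (a +_)) ≤ ∑< n f
∑<-tail zero    n       f = ≤-refl
∑<-tail (suc a) zero    f = z≤n
∑<-tail (suc a) (suc n) f = ≤-trans (∑<-tail a n (f ∘ suc)) (m≤n+m _ (f 0))

-- The terms of `g` below `a` only enlarge the right side, so `f` and `g` are compared from `a` on.
-- This bridges a sum over lengths above `t` and a count over all lengths.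
∑≤∑< : ∀ a b (f g : ℕ → ℕ) → (∀ k → f (a + k) ≤ g (a + k)) → ∑ a b f ≤ ∑< (suc b) g
∑≤∑< a b f g f≤g = begin
  ∑ a b f                         ≡⟨ cong sum (map-applyUpTo (a +_) f (suc b ∸ a)) ⟩
  ∑< (suc b ∸ a) (f ∘ (a +_))     ≤⟨ ∑<-mono (suc b ∸ a) f≤g ⟩
  ∑< (suc b ∸ a) (g ∘ (a +_))     ≤⟨ ∑<-tail a (suc b) g ⟩
  ∑< (suc b) g                    ∎
  where open ≤-Reasoning

-- Binomial transforms

binomialSum : ℕ → (ℕ → ℕ) → ℕ
binomialSum n g = ∑< (suc n) (λ i → (n C i) * g i)

binomialSum-+ : ∀ n (f g : ℕ → ℕ) →
  binomialSum n (λ i → f i + g i) ≡ binomialSum n f + binomialSum n g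
binomialSum-+ n f g = trans
  (∑<-cong (suc n) λ i → *-distribˡ-+ (n C i) (f i) (g i))
  (∑<-+ (suc n) (λ i → (n C i) * f i) (λ i → (n C i) * g i))

-- Pascal's rule. In the count below, the first summand belongs to an odd first coordinate, which
-- adds no letter to the word, and the second to an even one, which adds a letter.
binomialSum-suc : ∀ n (g : ℕ → ℕ) →
  binomialSum (suc n) g ≡ binomialSum n g + binomialSum n (g ∘ suc)
binomialSum-suc n g = begin
  h 0 + ∑< (suc n) (λ i → (suc n C suc i) * g (suc i))
    ≡⟨ cong (h 0 +_) (∑<-cong (suc n) pascal) ⟩
  h 0 + ∑< (suc n) (λ i → h (suc i) + (n C i) * g (suc i))
    ≡⟨ cong (h 0 +_) (∑<-+ (suc n) (h ∘ suc) (λ i → (n C i) * g (suc i))) ⟩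
  h 0 + (∑< (suc n) (h ∘ suc) + binomialSum n (g ∘ suc))
    ≡⟨ +-assoc (h 0) _ _ ⟨
  ∑< (2 + n) h + binomialSum n (g ∘ suc)
    -- The sum has one term more than `binomialSum n g`; that term vanishes because `n C suc n` is
    -- 0.
    ≡⟨ cong (_+ binomialSum n (g ∘ suc)) (∑<-last (suc n) h) ⟩
  (binomialSum n g + (n C suc n) * g (suc n)) + binomialSum n (g ∘ suc)
    ≡⟨ cong (λ c → (binomialSum n g + c * g (suc n)) + binomialSum n (g ∘ suc)) (k>n⇒nCk≡0 (n<1+n n)) ⟩
  (binomialSum n g + 0) + binomialSum n (g ∘ suc)
    ≡⟨ cong (_+ binomialSum n (g ∘ suc)) (+-identityʳ (binomialSum n g)) ⟩
  binomialSum n g + binomialSum n (g ∘ suc)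
    ∎
  where
  open ≡-Reasoning
  h : ℕ → ℕ
  h i = (n C i) * g i
  pascal : ∀ i → (suc n C suc i) * g (suc i) ≡ h (suc i) + (n C i) * g (suc i)
  pascal i = begin
    (suc n C suc i) * g (suc i)           ≡⟨ cong (_* g (suc i)) (nCk+nC[k+1]≡[n+1]C[k+1] n i) ⟨
    (n C i + n C suc i) * g (suc i)       ≡⟨ cong (_* g (suc i)) (+-comm (n C i) _) ⟩
    (n C suc i + n C i) * g (suc i)       ≡⟨ *-distribʳ-+ (g (suc i)) (n C suc i) (n C i) ⟩
    h (suc i) + (n C i) * g (suc i)       ∎

-- Counting and maximal subsets

∣_∣on_ : ∀ {A : Set} {P : Pred A 0ℓ} → Decidable P → List A → ℕ
∣ P? ∣on xs = length (filter P? xs)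

module _ {A : Set} {P : Pred A 0ℓ} (P? : Decidable P) where

  ∣∣on-++ : ∀ xs ys → ∣ P? ∣on (xs ++ ys) ≡ ∣ P? ∣on xs + ∣ P? ∣on ys
  ∣∣on-++ xs ys = trans (cong length (filter-++ P? xs ys)) (length-++ (filter P? xs))

  ∣∣on-map : ∀ {B : Set} (f : B → A) xs → ∣ P? ∣on (map f xs) ≡ ∣ P? ∘ f ∣on xs
  ∣∣on-map f []       = refl
  ∣∣on-map f (x ∷ xs) with does (P? (f x))
  ... | true  = cong suc (∣∣on-map f xs)
  ... | false = ∣∣on-map f xs

  ∣∣on-cartesianProductWith : ∀ {B D : Set} (f : B → D → A) xs ys →
    ∣ P? ∣on (cartesianProductWith f xs ys) ≡ sum (map (λ x → ∣ P? ∘ f x ∣on ys) xs)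
  ∣∣on-cartesianProductWith f []       ys = refl
  ∣∣on-cartesianProductWith f (x ∷ xs) ys = trans
    (∣∣on-++ (map (f x) ys) _)
    (cong₂ _+_ (∣∣on-map (f x) ys) (∣∣on-cartesianProductWith f xs ys))

  length≤∣∣on : ∀ {xs ys} → xs ⊆ ys → All P xs → length xs ≤ ∣ P? ∣on ys
  length≤∣∣on {xs} {ys} xs⊆ys all = begin
    length xs      ≡⟨ cong length (filter-all P? all) ⟨
    ∣ P? ∣on xs    ≤⟨ length-mono-≤ (⊆-filter-Sublist P? P? (λ { refl p → p }) xs⊆ys) ⟩
    ∣ P? ∣on ys    ∎
    where open ≤-Reasoning

  filter∈sublists : ∀ xs → filter P? xs ∈ sublists xs
  filter∈sublists []       = here refl
  filter∈sublists (x ∷ xs) with does (P? x)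
  ... | true  = ∈-++⁺ˡ (∈-map⁺ (x ∷_) (filter∈sublists xs))
  ... | false = ∈-++⁺ʳ (map (x ∷_) (sublists xs)) (filter∈sublists xs)

∈sublists⇒⊆ : ∀ {A : Set} (xs : List A) {ys} → ys ∈ sublists xs → ys ⊆ xs
∈sublists⇒⊆ []       (here refl) = []
∈sublists⇒⊆ (x ∷ xs) ys∈ with ∈-++⁻ (map (x ∷_) (sublists xs)) ys∈
... | inj₂ ys∈′ = x ∷ʳ ∈sublists⇒⊆ xs ys∈′
... | inj₁ ys∈′ with ∈-map⁻ (x ∷_) ys∈′
...   | zs , zs∈ , refl = refl ∷ ∈sublists⇒⊆ xs zs∈

module _ {m n : ℕ} {P : Pred (List (ℤ/ m ^ n)) 0ℓ} (P? : Decidable P) where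

  filter≤maxSize : ∀ {Q : Pred (ℤ/ m ^ n) 0ℓ} (Q? : Decidable Q) →
    P (filter Q? (elements m n)) → ∣ Q? ∣on elements m n ≤ maxSize P?
  filter≤maxSize Q? p = lookup (xs≤max 0 _)
    (∈-map⁺ length (∈-filter⁺ P? (filter∈sublists Q? (elements m n)) p))

  -- If the maximum is its base value 0, the empty set attains it; this is where `P []` enters.
  maxSize-attained : P [] → ∃ λ S → S ⊆ elements m n × P S × length S ≡ maxSize P?
  maxSize-attained p[] = argmax-all id
    {P = λ s → ∃ λ S → S ⊆ elements m n × P S × length S ≡ s}
    ([] , []⊆ _ , p[] , refl)
    (All.map⁺ (tabulate λ {S} S∈ →
      let S∈sublists , pS = ∈-filter⁻ P? {xs = sublists (elements m n)} S∈
      in S , ∈sublists⇒⊆ (elements m n) S∈sublists , pS , refl))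
    where
    []⊆ : ∀ (xs : List (ℤ/ m ^ n)) → [] ⊆ xs
    []⊆ []       = []
    []⊆ (x ∷ xs) = x ∷ʳ []⊆ xs

-- Encoding binary words of varying length in ℤ₄ⁿ

-- The length `i` is the number of even coordinates. A coordinate 1 contributes no letter, and 3 is
-- excluded by having no constructor.
data _encodes_ : ∀ {n i} → ℤ/ 4 ^ n → ℤ/ 2 ^ i → Set where
  []   : [] encodes []
  zero : ∀ {n i} {x : ℤ/ 4 ^ n} {u : ℤ/ 2 ^ i} → x encodes u → (0F ∷ x) encodes (0F ∷ u)
  one  : ∀ {n i} {x : ℤ/ 4 ^ n} {u : ℤ/ 2 ^ i} → x encodes u → (1F ∷ x) encodes u
  two  : ∀ {n i} {x : ℤ/ 4 ^ n} {u : ℤ/ 2 ^ i} → x encodes u → (2F ∷ x) encodes (1F ∷ u)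

private variable
  n i j k : ℕ

-- The first and last terms differ by twice `d`, so their parities agree everywhere. In each absurd
-- case the second or third term has a coordinate 3. Equal lengths make `hamming` applicable to the
-- two end words.
endpoints-same-length : ∀ {x : ℤ/ 4 ^ n} d {u : ℤ/ 2 ^ i} {w : ℤ/ 2 ^ j} {v : ℤ/ 2 ^ k} →
  x encodes u → (x ⊕ d) encodes w → ((x ⊕ d) ⊕ d) encodes v → i ≡ k
endpoints-same-length []       []       []       []       = refl
endpoints-same-length (0F ∷ d) (zero a) (zero b) (zero c) = cong suc (endpoints-same-length d a b c)
endpoints-same-length (1F ∷ d) (zero a) (one b)  (two c)  = cong suc (endpoints-same-length d a b c)
endpoints-same-length (2F ∷ d) (zero a) (two b)  (zero c) = cong suc (endpoints-same-length d a b c)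
endpoints-same-length (3F ∷ d) (zero a) ()
endpoints-same-length (0F ∷ d) (one a)  (one b)  (one c)  = endpoints-same-length d a b c
endpoints-same-length (1F ∷ d) (one a)  (two b)  ()
endpoints-same-length (2F ∷ d) (one a)  ()
endpoints-same-length (3F ∷ d) (one a)  (zero b) ()
endpoints-same-length (0F ∷ d) (two a)  (two b)  (two c)  = cong suc (endpoints-same-length d a b c)
endpoints-same-length (1F ∷ d) (two a)  ()
endpoints-same-length (2F ∷ d) (two a)  (zero b) (two c)  = cong suc (endpoints-same-length d a b c)
endpoints-same-length (3F ∷ d) (two a)  (one b)  (zero c) = cong suc (endpoints-same-length d a b c)

-- Each even coordinate of `x` is counted once. Where `d` is odd, the end letters differ and the
-- middle term is odd; where `d` is even, the letters agree and the middle term is even, which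
-- counts towards `j`. At odd coordinates of `x`, `d` must be 0.
hamming-endpoints : ∀ {x : ℤ/ 4 ^ n} d {u v : ℤ/ 2 ^ i} {w : ℤ/ 2 ^ j} →
  x encodes u → (x ⊕ d) encodes w → ((x ⊕ d) ⊕ d) encodes v → hamming u v + j ≡ i
hamming-endpoints []       []       []       []       = refl
hamming-endpoints (0F ∷ d) (zero a) (zero b) (zero c) = trans (+-suc _ _) (cong suc (hamming-endpoints d a b c))
hamming-endpoints (1F ∷ d) (zero a) (one b)  (two c)  = cong suc (hamming-endpoints d a b c)
hamming-endpoints (2F ∷ d) (zero a) (two b)  (zero c) = trans (+-suc _ _) (cong suc (hamming-endpoints d a b c))
hamming-endpoints (3F ∷ d) (zero a) ()
hamming-endpoints (0F ∷ d) (one a)  (one b)  (one c)  = hamming-endpoints d a b c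
hamming-endpoints (1F ∷ d) (one a)  (two b)  ()
hamming-endpoints (2F ∷ d) (one a)  ()
hamming-endpoints (3F ∷ d) (one a)  (zero b) ()
hamming-endpoints (0F ∷ d) (two a)  (two b)  (two c)  = trans (+-suc _ _) (cong suc (hamming-endpoints d a b c))
hamming-endpoints (1F ∷ d) (two a)  ()
hamming-endpoints (2F ∷ d) (two a)  (zero b) (two c)  = trans (+-suc _ _) (cong suc (hamming-endpoints d a b c))
hamming-endpoints (3F ∷ d) (two a)  (one b)  (zero c) = cong suc (hamming-endpoints d a b c)

-- An odd entry of `d` at an even coordinate would flip the letter there, so a common word forces
-- all entries of `d` to be even, and twice `d` is 0.
endpoints-injective : ∀ {x : ℤ/ 4 ^ n} d {u : ℤ/ 2 ^ i} {w : ℤ/ 2 ^ j} →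
  x encodes u → (x ⊕ d) encodes w → ((x ⊕ d) ⊕ d) encodes u → x ≡ (x ⊕ d) ⊕ d
endpoints-injective []       []       []       []       = refl
endpoints-injective (0F ∷ d) (zero a) (zero b) (zero c) = cong (0F ∷_) (endpoints-injective d a b c)
endpoints-injective (1F ∷ d) (zero a) (one b)  ()
endpoints-injective (2F ∷ d) (zero a) (two b)  (zero c) = cong (0F ∷_) (endpoints-injective d a b c)
endpoints-injective (3F ∷ d) (zero a) ()
endpoints-injective (0F ∷ d) (one a)  (one b)  (one c)  = cong (1F ∷_) (endpoints-injective d a b c)
endpoints-injective (1F ∷ d) (one a)  (two b)  ()
endpoints-injective (2F ∷ d) (one a)  ()
endpoints-injective (3F ∷ d) (one a)  (zero b) ()
endpoints-injective (0F ∷ d) (two a)  (two b)  (two c)  = cong (2F ∷_) (endpoints-injective d a b c)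
endpoints-injective (1F ∷ d) (two a)  ()
endpoints-injective (2F ∷ d) (two a)  (zero b) (two c)  = cong (2F ∷_) (endpoints-injective d a b c)
endpoints-injective (3F ∷ d) (two a)  (one b)  ()

-- Families of words and the number of their encodings

Words : Set₁
Words = ∀ i → Pred (ℤ/ 2 ^ i) 0ℓ

-- The left quotient of a language by the letter `a`.
_after_ : Words → Fin 2 → Words
(P after a) i u = P (suc i) (a ∷ u)

-- Equivalent to ∃₂ λ i u → x encodes u × P i u, but recursive so that filtering
-- the elements of ℤ₄ⁿ by the first coordinate computes.
Encoded : Words → Pred (ℤ/ 4 ^ n) 0ℓ
Encoded P []       = P 0 []
Encoded P (0F ∷ x) = Encoded (P after 0F) x
Encoded P (1F ∷ x) = Encoded P x
Encoded P (2F ∷ x) = Encoded (P after 1F) x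
Encoded P (3F ∷ x) = ⊥

encoded? : ∀ {P : Words} → (∀ i → Decidable (P i)) → Decidable (Encoded {n} P)
encoded? P? []       = P? 0 []
encoded? P? (0F ∷ x) = encoded? (λ i u → P? (suc i) (0F ∷ u)) x
encoded? P? (1F ∷ x) = encoded? P? x
encoded? P? (2F ∷ x) = encoded? (λ i u → P? (suc i) (1F ∷ u)) x
encoded? P? (3F ∷ x) = no id

decode : ∀ {P : Words} (x : ℤ/ 4 ^ n) → Encoded P x → ∃₂ λ i u → x encodes u × P i u
decode []       p = 0 , [] , [] , p
decode (0F ∷ x) p = let i , u , e , q = decode x p in suc i , 0F ∷ u , zero e , q
decode (1F ∷ x) p = let i , u , e , q = decode x p in i , u , one e , q
decode (2F ∷ x) p = let i , u , e , q = decode x p in suc i , 1F ∷ u , two e , q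
decode (3F ∷ x) ()

-- Induction on the first coordinate: 1 keeps the family `P`, 0 and 2 pass to its two quotients, and
-- 3 contributes nothing. `binomialSum-suc` splits the other side in the same way.
count-encoded : ∀ n {P : Words} (P? : ∀ i → Decidable (P i)) →
  binomialSum n (λ i → ∣ P? i ∣on elements 2 i) ≡ ∣ encoded? P? ∣on elements 4 n
count-encoded zero    P? with does (P? 0 [])
... | true  = refl
... | false = refl
count-encoded (suc n) {P} P? = begin
  binomialSum (suc n) (λ i → ∣ P? i ∣on elements 2 i)
    ≡⟨ binomialSum-suc n (λ i → ∣ P? i ∣on elements 2 i) ⟩
  b + binomialSum n (λ i → ∣ P? (suc i) ∣on elements 2 (suc i))
    ≡⟨ cong (b +_) (∑<-cong (suc n) λ i → cong ((n C i) *_) (split i)) ⟩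
  b + binomialSum n (λ i → ∣ P₀? i ∣on elements 2 i + ∣ P₁? i ∣on elements 2 i)
    ≡⟨ cong (b +_) (binomialSum-+ n (λ i → ∣ P₀? i ∣on elements 2 i) (λ i → ∣ P₁? i ∣on elements 2 i)) ⟩
  b + (b₀ + b₁)
    ≡⟨ rearrange ⟩
  b₀ + (b + (b₁ + 0))
    ≡⟨ cong₂ _+_ (count-encoded n P₀?) (cong₂ _+_ (count-encoded n P?) (cong₂ _+_ (count-encoded n P₁?) (sym none))) ⟩
  sum (map (λ a → ∣ encoded? P? ∘ (a ∷_) ∣on elements 4 n) (allFin 4))
    ≡⟨ ∣∣on-cartesianProductWith (encoded? P?) _∷_ (allFin 4) (elements 4 n) ⟨
  ∣ encoded? P? ∣on elements 4 (suc n)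
    ∎
  where
  open ≡-Reasoning
  P₀? : ∀ i → Decidable ((P after 0F) i)
  P₀? i u = P? (suc i) (0F ∷ u)
  P₁? : ∀ i → Decidable ((P after 1F) i)
  P₁? i u = P? (suc i) (1F ∷ u)
  b b₀ b₁ : ℕ
  b  = binomialSum n (λ i → ∣ P? i ∣on elements 2 i)
  b₀ = binomialSum n (λ i → ∣ P₀? i ∣on elements 2 i)
  b₁ = binomialSum n (λ i → ∣ P₁? i ∣on elements 2 i)
  split : ∀ i → ∣ P? (suc i) ∣on elements 2 (suc i) ≡ ∣ P₀? i ∣on elements 2 i + ∣ P₁? i ∣on elements 2 i
  split i = trans
    (∣∣on-cartesianProductWith (P? (suc i)) _∷_ (allFin 2) (elements 2 i))
    (cong (∣ P₀? i ∣on elements 2 i +_) (+-identityʳ _))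
  -- The right side lists the first coordinates in the order 0, 1, 2, 3; the final 0 is the share of
  -- 3.
  rearrange : b + (b₀ + b₁) ≡ b₀ + (b + (b₁ + 0))
  rearrange = begin
    b + (b₀ + b₁)          ≡⟨ +-assoc b b₀ b₁ ⟨
    (b + b₀) + b₁          ≡⟨ cong₂ _+_ (+-comm b b₀) (sym (+-identityʳ b₁)) ⟩
    (b₀ + b) + (b₁ + 0)    ≡⟨ +-assoc b₀ b _ ⟩
    b₀ + (b + (b₁ + 0))    ∎
  none : ∣ encoded? P? ∘ (3F ∷_) ∣on elements 4 n + 0 ≡ 0
  none = trans (+-identityʳ _)
    (cong length (filter-none (encoded? P? ∘ (3F ∷_)) (universal (λ _ → id) (elements 4 n))))

-- The progression-free set built from optimal codes

module _ (t : ℕ) where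

  optimal : ∀ i → ∃ λ K → K ⊆ elements 2 i × MinDistance≥ (i ∸ t) K × length K ≡ codeSize i (i ∸ t)
  optimal i = maxSize-attained (minDistance≥? (i ∸ t)) []

  -- The condition `t < i` leaves out the short codes, so that every encoded point has more than `t`
  -- even coordinates.
  Codewords : Words
  Codewords i u = t < i × u ∈ proj₁ (optimal i)

  codewords? : ∀ i → Decidable (Codewords i)
  codewords? i u = (t <? i) ×-dec (u ∈? proj₁ (optimal i))
    where open DecMembership _≟ᵛ_ using (_∈?_)

  codeSize≤codewords : t < i → codeSize i (i ∸ t) ≤ ∣ codewords? i ∣on elements 2 i
  codeSize≤codewords {i} t<i = let K , K⊆ , _ , ∣K∣≡ = optimal i in
    ≤-trans (≤-reflexive (sym ∣K∣≡)) (length≤∣∣on (codewords? i) K⊆ (tabulate (t<i ,_)))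

  ∈encoded⇒word : ∀ {x : ℤ/ 4 ^ n} → x ∈ filter (encoded? codewords?) (elements 4 n) →
    ∃₂ λ i u → x encodes u × Codewords i u
  ∈encoded⇒word {n} {x} x∈ = decode x (proj₂ (∈-filter⁻ (encoded? codewords?) {xs = elements 4 n} x∈))

  encoded-apFree : APFree 3 (filter (encoded? codewords?) (elements 4 n))
  encoded-apFree (x , d , (_ ∷ x≢z ∷ []) ∷ _ , x∈ ∷ y∈ ∷ z∈ ∷ [])
    with i , u , x↦u , _ , u∈ ← ∈encoded⇒word x∈
       | j , w , y↦w , t<j , _ ← ∈encoded⇒word y∈
       | k , v , z↦v , _ , v∈ ← ∈encoded⇒word z∈
    -- From here on `u` and `v` lie in the same optimal code.
    with refl ← endpoints-same-length d x↦u y↦w z↦v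
    = <-irrefl refl (begin-strict
        i                  ≤⟨ m≤n+m∸n i t ⟩
        t + (i ∸ t)        ≤⟨ +-monoʳ-≤ t distance ⟩
        -- Strictness comes from the middle term, which has `j` even coordinates with `t < j`.
        t + hamming u v    <⟨ +-monoˡ-< (hamming u v) t<j ⟩
        j + hamming u v    ≡⟨ +-comm j _ ⟩
        hamming u v + j    ≡⟨ hamming-endpoints d x↦u y↦w z↦v ⟩
        i                  ∎)
    where
    open ≤-Reasoning
    u≢v : u ≢ v
    u≢v refl = x≢z (endpoints-injective d x↦u y↦w z↦v)
    distance : i ∸ t ≤ hamming u v
    distance = let _ , _ , minDistance , _ = optimal i in lookup (lookup minDistance u∈) v∈ u≢v

  ∑≤r : ∀ n → ∑ (t + 1) n (λ i → (n C i) * codeSize i (i ∸ t)) ≤ r 3 4 n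
  ∑≤r n = begin
    ∑ (t + 1) n (λ i → (n C i) * codeSize i (i ∸ t))
      ≤⟨ ∑≤∑< (t + 1) n _ (λ i → (n C i) * ∣ codewords? i ∣on elements 2 i)
           (λ k → *-monoʳ-≤ (n C (t + 1 + k)) (codeSize≤codewords (t<t+1+ k))) ⟩
    binomialSum n (λ i → ∣ codewords? i ∣on elements 2 i)
      ≡⟨ count-encoded n codewords? ⟩
    ∣ encoded? codewords? ∣on elements 4 n
      ≤⟨ filter≤maxSize (apFree? 3) (encoded? codewords?) (encoded-apFree {n}) ⟩
    r 3 4 n
      ∎
    where
    open ≤-Reasoning
    t<t+1+ : ∀ k → t < t + 1 + k
    t<t+1+ k = ≤-trans (≤-reflexive (+-comm 1 t)) (m≤m+n (t + 1) k)

theorem3p2 : (n : ℕ) → 1 < n →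
    r 3 4 n ≥ Max 0 n (λ t → ∑ (t + 1) n (λ i → (n C i) * codeSize i (i ∸ t)))
-- `z≤n` bounds the base value 0 of the maximum, and `∑≤r` bounds the entry for each `t`.
theorem3p2 n _ = max≤v⁺ z≤n (All.map⁺ (universal (λ t → ∑≤r t n) (range 0 n)))
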